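{- Let $X=\{a,b,c\}$, $S=X^*$, and let $\mathcal{L}\subseteq 2^{X^*}$ be a nontrivial language family which is closed under finite unions, under left markers ($wL\in\mathcal{L}$ for $w\in X^*$, $L\in\mathcal{L}$), under left quotients by words ($w^{ -1}L=\{v\in X^*: wv\in L\}\in\mathcal{L}$ for $w\in X^*$, $L\in\mathcal{L}$), and under regular variation ($L\cup R\in\mathcal{L}$ and $L\cap R\in\mathcal{L}$ for all $L\in\mathcal{L}$ and regular $R\subseteq X^*$). Let $A\subseteq X^*$ with $A\notin\mathcal{L}$ or $X^*\setminus A\notin\mathcal{L}$, and put $A_{xy}=xA\cup y(X^*\setminus A)$ for $x,y\in X$ and $\mathbf{C}(A)=(A_{ab},A_{bc},A_{ca})$. Then $\mathbf{C}(A)\notin\mathit{class}_3(\mathcal{L})$, and for every classification problem $\mathbf{B}\le\mathbf{C}(A)$ with $|\mathbf{B}|=3$ we have $\mathbf{B}\notin\mathit{core}_3(\mathcal{L})$.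
   Context: $\mathcal{L}$ is nontrivial if $\emptyset,X^*\in\mathcal{L}$ and for all $Q\in\mathcal{L}$ and finite $E\subseteq X^*$ both $Q\cup E\in\mathcal{L}$ and $Q\setminus E\in\mathcal{L}$. A classification problem is a vector $(A_1,\dots,A_k)$, $k\ge1$, of pairwise disjoint infinite subsets of $X^*$, of length $k$. For vectors $\mathbf{B}=(B_1,\dots,B_m)$, $\mathbf{Q}=(Q_1,\dots,Q_k)$, $\mathbf{B}\le\mathbf{Q}$ means $1\le m\le k$ and there is an injective $\sigma:\{1,\dots,m\}\to\{1,\dots,k\}$ with $B_i\subseteq Q_{\sigma(i)}$. An $\mathcal{L}$-partition is a vector of pairwise disjoint members of $\mathcal{L}$ whose union is $X^*$. $\mathit{class}_k(\mathcal{L})$: classification problems $\mathbf{A}$ of length $k$ with $\mathbf{A}\le\mathbf{Q}$ for some $\mathcal{L}$-partition $\mathbf{Q}$ of length $k$. For $k>1$, $\mathit{core}_k(\mathcal{L})$ is the set of classification problems $\mathbf{A}$ of length $k$ such that every classification problem $\mathbf{A}'\le\mathbf{A}$ with $|\mathbf{A}'|>1$ satisfies $\mathbf{A}'\notin\mathit{class}_{|\mathbf{A}'|}(\mathcal{L})$. -}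

module Defs where

open import Level using (Level; 0ℓ; suc; _⊔_)
open import Data.Fin using (Fin)
open import Data.List using (List; []; _∷_; _++_)
import Data.List.Membership.Propositional as List
open import Data.Nat using (ℕ; _≤_; _<_)
open import Data.Product using (Σ; _×_)
open import Data.Vec.Functional using (Vector) renaming ([] to []ᵥ; _∷_ to _∷ᵥ_)
open import Function.Definitions using (Injective)
open import Relation.Binary.PropositionalEquality using (_≡_; _≢_; preorder)
open import Relation.Nullary using (¬_)
open import Relation.Unary using (Pred; _∈_; _∉_; _⊆_; _≐_; _⊥_; ∅; U; ∁; _∪_; _∩_; _∖_; ⋃)
import Text.Regex.Base as RegexBase

private
  variable
    ℓ : Level
    k : ℕ

data X : Set where
  a b c : X

Word : Set
Word = List X

Language : Set₁
Language = Pred Word 0ℓ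

-- Sets of words are compared with _≐_, so a subset of 2^{X*} is a family that
-- moreover satisfies `𝓛 Respects _≐_`; this is assumed separately where needed.
Family : (ℓ : Level) → Set (suc 0ℓ ⊔ suc ℓ)
Family ℓ = Pred Language ℓ

Finite : Language → Set
Finite E = Σ (List Word) λ ws → E ≐ (List._∈ ws)

Infinite : Language → Set
Infinite E = ¬ Finite E

-- Character ranges are taken with respect to the discrete order on X.
module Regex = RegexBase (preorder X)

Regular : Language → Set
Regular R = Σ Regex.Exp λ e → R ≐ (Regex._∈ e)

infixr 8 _·_ _⁻¹·_

_·_ : Word → Language → Language
(w · L) u = Σ Word λ v → v ∈ L × u ≡ w ++ v

_⁻¹·_ : Word → Language → Language
(w ⁻¹· L) v = (w ++ v) ∈ L

record Nontrivial (𝓛 : Family ℓ) : Set (suc 0ℓ ⊔ ℓ) where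
  field
    ∅∈       : ∅ ∈ 𝓛
    U∈       : U ∈ 𝓛
    ∪-finite : ∀ {Q E} → Q ∈ 𝓛 → Finite E → (Q ∪ E) ∈ 𝓛
    ∖-finite : ∀ {Q E} → Q ∈ 𝓛 → Finite E → (Q ∖ E) ∈ 𝓛

ClosedUnderFiniteUnions : Family ℓ → Set (suc 0ℓ ⊔ ℓ)
ClosedUnderFiniteUnions 𝓛 =
  ∀ n (M : Vector Language n) → (∀ i → M i ∈ 𝓛) → ⋃ (Fin n) M ∈ 𝓛

ClosedUnderLeftMarkers : Family ℓ → Set (suc 0ℓ ⊔ ℓ)
ClosedUnderLeftMarkers 𝓛 = ∀ w {L} → L ∈ 𝓛 → (w · L) ∈ 𝓛

ClosedUnderLeftQuotients : Family ℓ → Set (suc 0ℓ ⊔ ℓ)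
ClosedUnderLeftQuotients 𝓛 = ∀ w {L} → L ∈ 𝓛 → (w ⁻¹· L) ∈ 𝓛

ClosedUnderRegularVariation : Family ℓ → Set (suc 0ℓ ⊔ ℓ)
ClosedUnderRegularVariation 𝓛 =
  ∀ {L R} → L ∈ 𝓛 → Regular R → (L ∪ R) ∈ 𝓛 × (L ∩ R) ∈ 𝓛

PairwiseDisjoint : Vector Language k → Set
PairwiseDisjoint A = ∀ {i j} → i ≢ j → A i ⊥ A j

record IsClassificationProblem {k : ℕ} (A : Vector Language k) : Set where
  field
    k≥1      : 1 ≤ k
    disjoint : PairwiseDisjoint A
    infinite : ∀ i → Infinite (A i)

infix 4 _≼_

record _≼_ {m k : ℕ} (B : Vector Language m) (Q : Vector Language k) : Set where
  field
    1≤m         : 1 ≤ m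
    m≤k         : m ≤ k
    σ           : Fin m → Fin k
    σ-injective : Injective _≡_ _≡_ σ
    contained   : ∀ i → B i ⊆ Q (σ i)

record IsPartition {k : ℕ} (𝓛 : Family ℓ) (Q : Vector Language k) : Set (suc 0ℓ ⊔ ℓ) where
  field
    member   : ∀ i → Q i ∈ 𝓛
    disjoint : PairwiseDisjoint Q
    covers   : ⋃ (Fin k) Q ≐ U

class : (k : ℕ) → Family ℓ → Pred (Vector Language k) (suc 0ℓ ⊔ ℓ)
class k 𝓛 A =
  IsClassificationProblem A × Σ (Vector Language k) λ Q → IsPartition 𝓛 Q × A ≼ Q

record core (k : ℕ) (𝓛 : Family ℓ) (A : Vector Language k) : Set (suc 0ℓ ⊔ ℓ) where
  field
    k>1       : 1 < k
    isProblem : IsClassificationProblem A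
    hard      : ∀ {m} (A′ : Vector Language m) → IsClassificationProblem A′ →
                A′ ≼ A → 1 < m → A′ ∉ class m 𝓛

mix : Language → X → X → Language
mix A x y = ((x ∷ []) · A) ∪ ((y ∷ []) · ∁ A)

𝐂 : Language → Vector Language 3
𝐂 A = mix A a b ∷ᵥ mix A b c ∷ᵥ mix A c a ∷ᵥ []ᵥ

{-# OPTIONS --safe #-}
-- Membership: a word av lies in A_ab or in A_ca according to whether v ∈ A, so a
-- partition separating the components of C(A) has A and its complement among the
-- left quotients by a of its classes.
--
-- Core: each component of C(A) uses two initial letters and each letter is missing
-- from exactly one component.  Every component of B is infinite on some initial
-- letter, and these letters cannot all agree, so two components have infinite parts
-- in distinct cones xX*, yX*; the partition (xX*, X* ∖ xX*) separates these parts.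
module Submission where

open import Defs
open import Level using (Level; 0ℓ)
open import Axiom.ExcludedMiddle using (ExcludedMiddle)
open import Axiom.DoubleNegationElimination using (em⇒dne)
open import Data.Empty using (⊥-elim)
open import Data.Fin using (Fin; zero; suc; punchOut)
open import Data.Fin.Properties using (0≢1+n; injective⇒≤; punchOut-injective)
open import Data.List using ([]; _∷_; _++_)
open import Data.List.Properties using (∷-injectiveˡ)
open import Data.List.Membership.Propositional.Properties using (∈-++⁺ˡ; ∈-++⁺ʳ; ∈-++⁻)
open import Data.List.Relation.Unary.Any using (here)
open import Data.Nat using (ℕ; z≤n; s≤s)
open import Data.Nat.Properties using (1+n≰n)
open import Data.Product using (_×_; _,_; proj₁; proj₂; ∃; ∃₂)
open import Data.Sum using (_⊎_; inj₁; inj₂; [_,_]′)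
open import Data.Unit using (tt)
open import Data.Vec.Functional using (Vector) renaming ([] to []ᵥ; _∷_ to _∷ᵥ_)
open import Function using (_∘_; id)
open import Function.Definitions using (Injective)
open import Relation.Binary.Definitions using (_Respects_)
open import Relation.Binary.PropositionalEquality using (_≡_; _≢_; refl; sym; trans; cong)
open import Relation.Nullary using (¬_; yes; no)
open import Relation.Unary using (_∈_; _∉_; _⊆_; _≐_; _⊥_; U; ∁; _∪_; _∩_; ⋃)

private
  variable
    k m : ℕ

-- If `j` were missed, deleting it from the codomain with `punchOut` would inject a finite set into
-- one with fewer elements.
injective⇒hits : ∀ {σ : Fin k → Fin k} → Injective _≡_ _≡_ σ → ∀ j → ¬ (∀ i → σ i ≢ j)
injective⇒hits {k = ℕ.suc _} σ-inj j miss =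
  1+n≰n (injective⇒≤ {f = λ i → punchOut (miss i ∘ sym)}
    (σ-inj ∘ punchOut-injective (miss _ ∘ sym) (miss _ ∘ sym)))

-- If both pieces were finite, concatenating their enumerations would enumerate `L`.
infinite-split : ExcludedMiddle 0ℓ → ∀ {L P Q : Language} → L ⊆ P ∪ Q → Infinite L →
                 Infinite (L ∩ P) ⊎ Infinite (L ∩ Q)
infinite-split em {L} {P} {Q} L⊆P∪Q L-inf
  with em {P = Finite (L ∩ P)} | em {P = Finite (L ∩ Q)}
... | no ¬f | _ = inj₁ ¬f
... | _ | no ¬f = inj₂ ¬f
... | yes (us , ⊆us , us⊆) | yes (vs , ⊆vs , vs⊆) = ⊥-elim (L-inf (us ++ vs , to , from))
  where
  to : ∀ {w} → w ∈ L → _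
  to w∈L with L⊆P∪Q w∈L
  ... | inj₁ w∈P = ∈-++⁺ˡ (⊆us (w∈L , w∈P))
  ... | inj₂ w∈Q = ∈-++⁺ʳ us (⊆vs (w∈L , w∈Q))
  from : ∀ {w} → _ → w ∈ L
  from w∈ = [ proj₁ ∘ us⊆ , proj₁ ∘ vs⊆ ]′ (∈-++⁻ us w∈)

-- Disjointness pulls back along the injective `σ`; infinitude does not pass to subsets and is
-- therefore assumed.
≼-isClassificationProblem : {B : Vector Language m} {Q : Vector Language k} →
  PairwiseDisjoint Q → B ≼ Q → (∀ i → Infinite (B i)) → IsClassificationProblem B
≼-isClassificationProblem Q-disj B≼Q B-inf = record
  { k≥1      = 1≤m
  ; disjoint = λ i≢j (w∈i , w∈j) → Q-disj (i≢j ∘ σ-injective) (contained _ w∈i , contained _ w∈j)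
  ; infinite = B-inf
  }
  where open _≼_ B≼Q

cone : X → Language
cone x = (x ∷ []) · U

·⊆cone : ∀ x (L : Language) → (x ∷ []) · L ⊆ cone x
·⊆cone x L (v , _ , eq) = v , tt , eq

cone-disjoint : ∀ {x y} → x ≢ y → cone x ⊥ cone y
cone-disjoint x≢y ((_ , _ , eq) , (_ , _ , eq′)) = x≢y (∷-injectiveˡ (trans (sym eq) eq′))

mix⊆cones : ∀ A x y → mix A x y ⊆ cone x ∪ cone y
mix⊆cones A x y = [ inj₁ ∘ ·⊆cone x A , inj₂ ∘ ·⊆cone y (∁ A) ]′

-- The only component of 𝐂 A without words that begin with the given letter.
missing : X → Fin 3
missing a = suc zero
missing b = suc (suc zero)
missing c = zero

-- The inequality `j ≢ missing x` is the form in which the choice of letter is used later: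
-- components choosing the same letter `x` all avoid one common index.
infinite-cone : ExcludedMiddle 0ℓ → ∀ A j {L} → L ⊆ 𝐂 A j → Infinite L →
                ∃ λ x → Infinite (L ∩ cone x) × j ≢ missing x
infinite-cone em A zero L⊆ L-inf
  with infinite-split em (mix⊆cones A a b ∘ L⊆) L-inf
... | inj₁ inf = a , inf , λ ()
... | inj₂ inf = b , inf , λ ()
infinite-cone em A (suc zero) L⊆ L-inf
  with infinite-split em (mix⊆cones A b c ∘ L⊆) L-inf
... | inj₁ inf = b , inf , λ ()
... | inj₂ inf = c , inf , λ ()
infinite-cone em A (suc (suc zero)) L⊆ L-inf
  with infinite-split em (mix⊆cones A c a ∘ L⊆) L-inf
... | inj₁ inf = c , inf , λ ()
... | inj₂ inf = a , inf , λ ()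

differing : ExcludedMiddle 0ℓ → (x : Fin 3 → X) → ¬ (∀ i → x i ≡ x zero) →
            ∃₂ λ i j → x i ≢ x j
differing em x ¬const with em {P = x (suc zero) ≡ x zero} | em {P = x (suc (suc zero)) ≡ x zero}
... | no x₁≢x₀ | _ = suc zero , zero , x₁≢x₀
... | _ | no x₂≢x₀ = suc (suc zero) , zero , x₂≢x₀
... | yes x₁≡x₀ | yes x₂≡x₀ =
  ⊥-elim (¬const λ { zero → refl ; (suc zero) → x₁≡x₀ ; (suc (suc zero)) → x₂≡x₀ })

separated-cones : ExcludedMiddle 0ℓ → ∀ A {B : Vector Language 3} →
  (∀ i → Infinite (B i)) → B ≼ 𝐂 A →
  ∃₂ λ i j → ∃₂ λ x y → i ≢ j × x ≢ y × Infinite (B i ∩ cone x) × Infinite (B j ∩ cone y)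
separated-cones em A {B} B-inf B≼C =
  let i , j , xᵢ≢xⱼ = differing em x ¬const
  in  i , j , x i , x j , xᵢ≢xⱼ ∘ cong x , xᵢ≢xⱼ , proj₁ (proj₂ (chosen i)) , proj₁ (proj₂ (chosen j))
  where
  open _≼_ B≼C
  chosen : ∀ i → ∃ λ x → Infinite (B i ∩ cone x) × σ i ≢ missing x
  chosen i = infinite-cone em A (σ i) (contained i) (B-inf i)
  x : Fin 3 → X
  x = proj₁ ∘ chosen
  ¬const : ¬ (∀ i → x i ≡ x zero)
  -- If all three letters agreed, the injection `σ` of `Fin 3` into itself would never take the
  -- value `missing (x zero)`.
  ¬const const = injective⇒hits σ-injective (missing (x zero))
    λ i eq → proj₂ (proj₂ (chosen i)) (trans eq (cong missing (sym (const i))))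

letter : Fin 3 → X
letter = a ∷ᵥ b ∷ᵥ c ∷ᵥ []ᵥ

letter-surjective : ∀ x → ∃ λ i → letter i ≡ x
letter-surjective a = zero , refl
letter-surjective b = suc zero , refl
letter-surjective c = suc (suc zero) , refl

module _ (em : ExcludedMiddle 0ℓ) {ℓ : Level} (𝓛 : Family ℓ) (resp : 𝓛 Respects _≐_) where

  -- The classes may be larger than the components they contain. Still, the quotients by `a` of two
  -- of them are disjoint and contain `A` and `∁ A` respectively, which forces equality.
  class⇒complemented : ClosedUnderLeftQuotients 𝓛 → ∀ A → 𝐂 A ∈ class 3 𝓛 → A ∈ 𝓛 × ∁ A ∈ 𝓛
  class⇒complemented quotients A (_ , Q , Q-part , C≼Q) =
    resp (a⁻¹Qab⊆A , A⊆a⁻¹Qab) (quotients (a ∷ []) (member (σ zero))) ,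
    resp (a⁻¹Qca⊆∁A , ∁A⊆a⁻¹Qca) (quotients (a ∷ []) (member (σ (suc (suc zero)))))
    where
    open IsPartition Q-part
    open _≼_ C≼Q
    Qab Qca : Language
    Qab = Q (σ zero)
    Qca = Q (σ (suc (suc zero)))
    Qab⊥Qca : Qab ⊥ Qca
    Qab⊥Qca = disjoint (0≢1+n ∘ σ-injective)
    A⊆a⁻¹Qab : A ⊆ (a ∷ []) ⁻¹· Qab
    A⊆a⁻¹Qab v∈A = contained zero (inj₁ (_ , v∈A , refl))
    ∁A⊆a⁻¹Qca : ∁ A ⊆ (a ∷ []) ⁻¹· Qca
    ∁A⊆a⁻¹Qca v∉A = contained (suc (suc zero)) (inj₂ (_ , v∉A , refl))
    a⁻¹Qab⊆A : (a ∷ []) ⁻¹· Qab ⊆ A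
    a⁻¹Qab⊆A av∈ = em⇒dne em λ v∉A → Qab⊥Qca (av∈ , ∁A⊆a⁻¹Qca v∉A)
    a⁻¹Qca⊆∁A : (a ∷ []) ⁻¹· Qca ⊆ ∁ A
    a⁻¹Qca⊆∁A av∈ v∈A = Qab⊥Qca (A⊆a⁻¹Qab v∈A , av∈)

  module _ (nontrivial : Nontrivial 𝓛) (unions : ClosedUnderFiniteUnions 𝓛)
           (markers : ClosedUnderLeftMarkers 𝓛) where

    open Nontrivial nontrivial

    -- By excluded middle this language is `U` or `∅`. It allows a letter to be switched on or off
    -- inside a union indexed by all letters.
    constant∈ : (P : Set) → (λ _ → P) ∈ 𝓛
    constant∈ P with em {P = P}
    ... | yes p = resp ((λ _ → p) , (λ _ → tt)) U∈
    ... | no ¬p = resp ((λ ()) , ¬p) ∅∈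

    -- X* ∖ xX* is the union of {ε} and the cones of the letters other than x.
    ∁-cone∈ : ∀ x → ∁ (cone x) ∈ 𝓛
    ∁-cone∈ x = resp (to , from) (∪-finite cones∈ ([] ∷ [] , here , λ { (here eq) → eq }))
      where
      otherCone : Vector Language 3
      -- This is the full cone of `letter i`, except that it is empty when `letter i` is `x`.
      otherCone i = (letter i ∷ []) · λ _ → x ≢ letter i
      cones∈ : ⋃ (Fin 3) otherCone ∈ 𝓛
      cones∈ = unions 3 otherCone λ i → markers (letter i ∷ []) (constant∈ _)
      to : ∀ {w} → w ∈ ⋃ (Fin 3) otherCone ∪ (_≡ []) → w ∈ ∁ (cone x)
      to (inj₁ (i , _ , x≢ , eq)) (_ , _ , eq′) = x≢ (∷-injectiveˡ (trans (sym eq′) eq))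
      to (inj₂ refl) (_ , _ , ())
      from : ∀ {w} → w ∈ ∁ (cone x) → w ∈ ⋃ (Fin 3) otherCone ∪ (_≡ [])
      from {[]} _ = inj₂ refl
      from {y ∷ v} ∉cone with letter-surjective y
      ... | i , refl = inj₁ (i , v , (λ { refl → ∉cone (v , tt , refl) }) , refl)

    cone-partition : ∀ x → IsPartition 𝓛 (cone x ∷ᵥ ∁ (cone x) ∷ᵥ []ᵥ)
    cone-partition x = record
      { member   = λ { zero → markers (x ∷ []) U∈ ; (suc zero) → ∁-cone∈ x }
      ; disjoint = disj
      ; covers   = (λ _ → tt) , λ _ → cover
      }
      where
      disj : PairwiseDisjoint (cone x ∷ᵥ ∁ (cone x) ∷ᵥ []ᵥ)
      disj {zero}     {zero}     0≢0 _        = 0≢0 refl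
      disj {zero}     {suc zero} _   (p , ¬p) = ¬p p
      disj {suc zero} {zero}     _   (¬p , p) = ¬p p
      disj {suc zero} {suc zero} 1≢1 _        = 1≢1 refl
      cover : ∀ {w} → w ∈ ⋃ (Fin 2) (cone x ∷ᵥ ∁ (cone x) ∷ᵥ []ᵥ)
      cover {w} with em {P = w ∈ cone x}
      ... | yes w∈ = zero , w∈
      ... | no  w∉ = suc zero , w∉

    -- The two infinite parts form a subproblem of length two that the partition by `cone x` solves,
    -- which contradicts `hard`.
    separated⇒∉core : ∀ {B : Vector Language k} → ∀ {i j x y} → i ≢ j → x ≢ y →
      Infinite (B i ∩ cone x) → Infinite (B j ∩ cone y) → B ∉ core k 𝓛
    separated⇒∉core {B = B} {i} {j} {x} {y} i≢j x≢y inf-i inf-j B-core =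
      hard parts problem parts≼B (s≤s (s≤s z≤n))
        (problem , _ , cone-partition x , parts≼cones)
      where
      open core B-core
      parts : Vector Language 2
      parts = (B i ∩ cone x) ∷ᵥ (B j ∩ cone y) ∷ᵥ []ᵥ
      ij : Fin 2 → Fin _
      ij = i ∷ᵥ j ∷ᵥ []ᵥ
      ij-injective : Injective _≡_ _≡_ ij
      ij-injective {zero}     {zero}     _  = refl
      ij-injective {zero}     {suc zero} eq = ⊥-elim (i≢j eq)
      ij-injective {suc zero} {zero}     eq = ⊥-elim (i≢j (sym eq))
      ij-injective {suc zero} {suc zero} _  = refl
      parts≼B : parts ≼ B
      parts≼B = record
        { 1≤m         = s≤s z≤n
        -- The inequality `1 < k` unfolds to `2 ≤ k`.
        ; m≤k         = k>1
        ; σ           = ij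
        ; σ-injective = ij-injective
        ; contained   = λ { zero → proj₁ ; (suc zero) → proj₁ }
        }
      problem : IsClassificationProblem parts
      problem = ≼-isClassificationProblem (IsClassificationProblem.disjoint isProblem) parts≼B
        λ { zero → inf-i ; (suc zero) → inf-j }
      parts≼cones : parts ≼ (cone x ∷ᵥ ∁ (cone x) ∷ᵥ []ᵥ)
      parts≼cones = record
        { 1≤m         = s≤s z≤n
        ; m≤k         = s≤s (s≤s z≤n)
        ; σ           = id
        ; σ-injective = id
        ; contained   = λ { zero → proj₂
                          -- The second part lies in `cone y`, which is disjoint from `cone x` and
                          -- hence inside its complement.
                          ; (suc zero) (_ , w∈y) w∈x → cone-disjoint x≢y (w∈x , w∈y) }
        }

theorem3p6 : ExcludedMiddle 0ℓ →
    ∀ {ℓ : Level} (𝓛 : Family ℓ) → 𝓛 Respects _≐_ →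
    Nontrivial 𝓛 →
    ClosedUnderFiniteUnions 𝓛 →
    ClosedUnderLeftMarkers 𝓛 →
    ClosedUnderLeftQuotients 𝓛 →
    ClosedUnderRegularVariation 𝓛 →
    (A : Language) → (A ∉ 𝓛) ⊎ (∁ A ∉ 𝓛) →
    (𝐂 A ∉ class 3 𝓛) ×
    ((B : Vector Language 3) → IsClassificationProblem B → B ≼ 𝐂 A → B ∉ core 3 𝓛)
theorem3p6 em 𝓛 resp nontrivial unions markers quotients _ A A∉⊎∁A∉ = C∉class , B∉core
  where
  C∉class : 𝐂 A ∉ class 3 𝓛
  C∉class C∈ =
    let A∈ , ∁A∈ = class⇒complemented em 𝓛 resp quotients A C∈
    in  [ (λ A∉ → A∉ A∈) , (λ ∁A∉ → ∁A∉ ∁A∈) ]′ A∉⊎∁A∉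
  B∉core : (B : Vector Language 3) → IsClassificationProblem B → B ≼ 𝐂 A → B ∉ core 3 𝓛
  B∉core B B-problem B≼C =
    let i , j , x , y , i≢j , x≢y , inf-i , inf-j =
          separated-cones em A (IsClassificationProblem.infinite B-problem) B≼C
    in  separated⇒∉core em 𝓛 resp nontrivial unions markers i≢j x≢y inf-i inf-j
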